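{- Let $a$ and $n$ be positive integers, let $S=\{x_1,\dots,x_n\}$ be a factor closed set of $n$ distinct positive integers indexed so that $x_1=1$, and let $f$ be an arithmetic function. Let $B=(b_{ij})$ be the $n\times n$ matrix with $b_{ij}=\mu\left(\frac{x_j}{x_i}\right)$ if $x_i\mid x_j$ and $b_{ij}=0$ otherwise, and let $B_{f^a}$ be the $n\times n$ matrix whose $(i,j)$-entry is $\mu\left(\frac{x_j}{x_i}\right)f\left(\frac{x_j}{x_i}\right)^a$ if $x_i\mid x_j$ and $0$ otherwise. (i) If $f$ is multiplicative, then $$B^T\big(f^a((x_i,x_j))\big)B=\operatorname{diag}\Big(1,\ \prod_{p\mid x_2}\big(f^a(p^{\nu_p(x_2)})-f^a(p^{\nu_p(x_2)-1})\big),\ \dots,\ \prod_{p\mid x_n}\big(f^a(p^{\nu_p(x_n)})-f^a(p^{\nu_p(x_n)-1})\big)\Big).$$ (ii) If $f$ is completely multiplicative, then $$B^T\big(f^a((x_i,x_j))\big)B=\operatorname{diag}\Big(1,\ \prod_{p\mid x_2}\big(f(p)^{a\nu_p(x_2)}-f(p)^{a(\nu_p(x_2)-1)}\big),\ \dots,\ \prod_{p\mid x_n}\big(f(p)^{a\nu_p(x_n)}-f(p)^{a(\nu_p(x_n)-1)}\big)\Big),$$ and moreover $$B_{f^a}^T\big(f^a([x_i,x_j])\big)B_{f^a}=\operatorname{diag}\Big(1,\ \prod_{p\mid x_2}\big(f(p)^{a\nu_p(x_2)}-f(p)^{a(\nu_p(x_2)+1)}\big),\ \dots,\ \prod_{p\mid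 x_n}\big(f(p)^{a\nu_p(x_n)}-f(p)^{a(\nu_p(x_n)+1)}\big)\Big).$$ All products run over the primes $p$ dividing the indicated integer.
   Context: $(x,y)$ denotes the greatest common divisor and $[x,y]$ the least common multiple. $f^a(x)$ means $f(x)^a$ (with $0^0=1$); $(f^a((x_i,x_j)))$ and $(f^a([x_i,x_j]))$ denote the $n\times n$ matrices with $(i,j)$-entries $f((x_i,x_j))^a$ and $f([x_i,x_j])^a$. A set $S$ of positive integers is factor closed if every positive divisor of every element of $S$ lies in $S$. $\mu$ is the Möbius function and $\nu_p(x)$ the $p$-adic valuation. An arithmetic function (complex-valued function on the positive integers) $f$ is multiplicative if $f(1)=1$ and $f(xy)=f(x)f(y)$ for coprime $x,y$; completely multiplicative if $f(1)=1$ and $f(xy)=f(x)f(y)$ for all $x,y$. -}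

module Defs where

open import Algebra.Bundles using (CommutativeRing)
open import Data.Bool.Base using (if_then_else_)
open import Data.Fin.Base using (Fin)
open import Data.Fin.Properties using () renaming (_≟_ to _≟ᶠ_)
open import Data.List.Base using (List; filter; foldr; length; map; upTo)
open import Data.List.Relation.Unary.Any using (any?)
open import Data.Nat.Base as ℕ using (ℕ; zero; suc; NonZero)
open import Data.Nat.Coprimality using (Coprime)
open import Data.Nat.Divisibility using (_∣_; _∣?_; quotient)
open import Data.Nat.GCD using (gcd)
open import Data.Nat.LCM using (lcm)
open import Data.Nat.Primality using (prime?)
open import Data.Product.Base using (∃-syntax; _×_)
open import Data.Vec.Functional using (Vector; transpose)
open import Relation.Binary.PropositionalEquality using (_≡_)
open import Relation.Nullary.Decidable using (does; yes; no; _×-dec_)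

-- For positive n; on n = 0 this is the junk value [].
primeDivisors : ℕ → List ℕ
primeDivisors n = filter (λ p → prime? p ×-dec (p ∣? n)) (upTo (suc n))

-- The largest k ≤ b with p ^ k ∣ n.
largestPower : (b p n : ℕ) → ℕ
largestPower zero    p n = 0
largestPower (suc b) p n =
  if does (p ℕ.^ suc b ∣? n) then suc b else largestPower b p n

-- The p-adic valuation for p ≥ 2 and n ≥ 1: then p ^ k ∣ n forces
-- k < 2 ^ k ≤ n, so bounding the search by n loses nothing.
ν : (p n : ℕ) → ℕ
ν p n = largestPower n p n

FactorClosed : ∀ {n} → Vector ℕ n → Set
FactorClosed x = ∀ i d → d ∣ x i → ∃[ j ] x j ≡ d

-- Arithmetic functions take values in an arbitrary commutative ring, in place
-- of ℂ.  They are total on ℕ for convenience; the value at 0 carries no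
-- hypothesis.
module Arithmetic {c ℓ} (R : CommutativeRing c ℓ) where

  open CommutativeRing R using (Carrier; _-_; 1#) public
  open CommutativeRing R using (_≈_; _*_; -_; 0#)
  open import Algebra.Properties.Semiring.Exp (CommutativeRing.semiring R) public using (_^_)
  open import Algebra.Properties.Semiring.Sum (CommutativeRing.semiring R) using (sum)

  Multiplicative : (ℕ → Carrier) → Set ℓ
  Multiplicative f = f 1 ≈ 1# ×
    (∀ m n .{{_ : NonZero m}} .{{_ : NonZero n}} → Coprime m n →
       f (m ℕ.* n) ≈ f m * f n)

  CompletelyMultiplicative : (ℕ → Carrier) → Set ℓ
  CompletelyMultiplicative f = f 1 ≈ 1# ×
    (∀ m n .{{_ : NonZero m}} .{{_ : NonZero n}} →
       f (m ℕ.* n) ≈ f m * f n)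

  -- 0 if n is divisible by the square of a prime, and otherwise (-1)^ω(n)
  -- with ω(n) the number of prime divisors of n.
  μ : ℕ → Carrier
  μ n = if does (any? (λ p → p ℕ.^ 2 ∣? n) (primeDivisors n))
        then 0#
        else (- 1#) ^ length (primeDivisors n)

  ∏[p∣_] : ℕ → (ℕ → Carrier) → Carrier
  ∏[p∣ n ] g = foldr _*_ 1# (map g (primeDivisors n))

  Matrix : ℕ → Set c
  Matrix n = Fin n → Fin n → Carrier

  infix 4 _≈ᴹ_
  _≈ᴹ_ : ∀ {n} → Matrix n → Matrix n → Set ℓ
  M ≈ᴹ N = ∀ i j → M i j ≈ N i j

  infixl 7 _*ᴹ_
  _*ᴹ_ : ∀ {n} → Matrix n → Matrix n → Matrix n
  (M *ᴹ N) i j = sum (λ k → M i k * N k j)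

  infix 8 _ᵀ
  _ᵀ : ∀ {n} → Matrix n → Matrix n
  _ᵀ = transpose

  diag : ∀ {n} → Vector Carrier n → Matrix n
  diag d i j = if does (i ≟ᶠ j) then d i else 0#

  gcdMatrix : ∀ {n} → (ℕ → Carrier) → ℕ → Vector ℕ n → Matrix n
  gcdMatrix f a x i j = f (gcd (x i) (x j)) ^ a

  lcmMatrix : ∀ {n} → (ℕ → Carrier) → ℕ → Vector ℕ n → Matrix n
  lcmMatrix f a x i j = f (lcm (x i) (x j)) ^ a

  -- (i , j) ↦ g (x j / x i) if x i divides x j, and 0 otherwise.
  quotientMatrix : ∀ {n} → (ℕ → Carrier) → Vector ℕ n → Matrix n
  quotientMatrix g x i j with x i ∣? x j
  ... | yes xᵢ∣xⱼ = g (quotient xᵢ∣xⱼ)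
  ... | no  _     = 0#

  B : ∀ {n} → Vector ℕ n → Matrix n
  B = quotientMatrix μ

  Bᶠ : ∀ {n} → (ℕ → Carrier) → ℕ → Vector ℕ n → Matrix n
  Bᶠ f a = quotientMatrix (λ q → μ q * f q ^ a)

{-# OPTIONS --safe #-}

-- Let θ be completely multiplicative, E = (θ(xⱼ/xᵢ)) over xᵢ ∣ xⱼ, and B the same
-- matrix for μθ.  Since S is factor closed, Möbius inversion gives E B = I.  If a
-- matrix M has entries θ(xᵢ/g) θ(xⱼ/g) G(g) with g = (xᵢ , xⱼ), and G = h ⋆ θ² as a
-- Dirichlet convolution, then M = Eᵀ diag(h(xᵢ)) E, so Bᵀ M B = diag(h(xᵢ)).
-- The gcd matrix is the case θ = 1, G = fᵃ; the lcm matrix is θ = G = fᵃ.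
-- Each convolution identity is an induction along n = p ^ (1 + k) * m with p ∤ m,
-- where both sides obey the same recursion in terms of p ^ k * m and m.
module Submission where

open import Defs
open import Level using (Level)
open import Algebra.Bundles using (CommutativeRing)
import Algebra.Properties.CommutativeMonoid.Sum as CommutativeMonoidSum
import Algebra.Properties.CommutativeSemiring.Exp as CommutativeSemiringExp
import Algebra.Properties.Group as GroupProperties
import Algebra.Properties.Ring as RingProperties
import Algebra.Properties.Semiring.Exp as SemiringExp
import Algebra.Properties.Semiring.Sum as SemiringSum
import Algebra.Solver.Ring.NaturalCoefficients.Default as NaturalCoefficients
open import Data.Bool.Base using (if_then_else_; true; false)
open import Data.Fin.Base using (Fin; zero; suc; punchIn; punchOut)
open import Data.Fin.Properties using (punchIn-injective; punchIn-punchOut; punchInᵢ≢i)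
  renaming (_≟_ to _≟ᶠ_)
open import Data.List.Base as List using (List; []; _++_; length; upTo)
open import Data.List.Membership.Propositional using (_∈_; _∉_; find; lose)
open import Data.List.Membership.Propositional.Properties
  using (∈-map⁺; ∈-map⁻; ∈-++⁺ˡ; ∈-++⁺ʳ; ∈-++⁻; ∈-filter⁺; ∈-filter⁻; ∈-upTo⁺)
open import Data.List.Membership.Propositional.Properties.WithK using (unique∧set⇒bag)
open import Data.List.Relation.Binary.BagAndSetEquality using (∼bag⇒↭)
open import Data.List.Relation.Binary.Permutation.Propositional using (_↭_; ↭⇒↭ₛ′)
open import Data.List.Relation.Binary.Permutation.Propositional.Properties
  using (↭-length) renaming (map⁺ to ↭-map⁺)
import Data.List.Relation.Binary.Permutation.Setoid.Properties as Permutation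
open import Data.List.Relation.Unary.All as All using ([])
import Data.List.Relation.Unary.All.Properties as All
open import Data.List.Relation.Unary.AllPairs as AllPairs using ([])
open import Data.List.Relation.Unary.Any using (here; there; any?)
open import Data.List.Relation.Unary.Unique.Propositional using (Unique)
open import Data.List.Relation.Unary.Unique.Propositional.Properties
  using (++⁺; map⁺; filter⁺; upTo⁺)
open import Data.Nat.Base as ℕ using (ℕ; zero; suc; NonZero; NonTrivial; z≤n; s≤s; _≤_; _<_)
open import Data.Nat.Coprimality using (Coprime; coprime-divisor)
open import Data.Nat.Divisibility
open import Data.Nat.GCD using (gcd; gcd[m,n]∣m; gcd[m,n]∣n; gcd-greatest; gcd[m,n]≢0)
open import Data.Nat.Induction using (<-rec)
open import Data.Nat.LCM using (lcm; gcd*lcm)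
open import Data.Nat.Primality
open import Data.Nat.Primality.Factorisation using (factorise)
import Data.Nat.Properties as ℕ
open import Data.Nat.Solver using (module +-*-Solver)
open import Data.Product.Base using (∃-syntax; Σ-syntax; _×_; _,_; proj₁; proj₂)
open import Data.Product.Properties using (,-injectiveˡ; ,-injectiveʳ)
open import Data.Sum.Base using (_⊎_; inj₁; inj₂)
open import Data.Vec.Functional using (Vector; _∷_; removeAt)
open import Function.Base using (_∘_; const)
open import Function.Bundles using (mk⇔)
open import Function.Definitions using (Injective)
open import Relation.Binary.PropositionalEquality as ≡ using (_≡_; _≢_)
open import Relation.Nullary using (¬_; yes; no; contradiction)
open import Relation.Nullary.Decidable using (does; dec-true; dec-false; _×-dec_)
open import Relation.Unary using (Decidable)

open +-*-Solver using () renaming (solve to ℕ-solve; _:*_ to _:*ℕ_; _:=_ to _:=ℕ_)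

-- Only the one-sided identity `E B = I` is established. Its transpose is `Bᵀ Eᵀ = I`, so it cancels
-- both outer factors of `Bᵀ Eᵀ diag(h) E B`. The lcm matrix is commonly written with a division by
-- the value of `f` at the gcd. That is impossible here, since `f` may vanish and the ring need not
-- have inverses. The shape θ(xᵢ/g) θ(xⱼ/g) G(g) avoids it, because the lcm is (xᵢ/g)(xⱼ/g)g. The
-- square in θ² arises because a divisor d of g leaves the factor g/d in both xᵢ/d and xⱼ/d. No
-- canonical list of divisors is fixed. The induction returns a list of factor pairs together with
-- the value of the sum over it. The matrix part uses only that the list is sound, complete and
-- duplicate free, so divisor sums never have to be rearranged.

-- Coprimality and prime powers.

prime∤⇒coprime : ∀ {p n} → Prime p → p ∤ n → Coprime p n
prime∤⇒coprime {n = n} pr p∤n (i∣p , i∣n) with prime⇒irreducible pr i∣p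
... | inj₁ i≡1 = i≡1
... | inj₂ i≡p = contradiction (≡.subst (_∣ n) i≡p i∣n) p∤n

-- A common divisor `i` is coprime to `p`, since whatever it shares with `p` also divides `n`. The
-- factors `p` can thus be stripped one at a time.
prime^∤⇒coprime : ∀ {p n} k → Prime p → p ∤ n → Coprime (p ℕ.^ k) n
prime^∤⇒coprime     zero    pr p∤n (i∣1 , _) = ∣1⇒≡1 i∣1
prime^∤⇒coprime {p} (suc k) pr p∤n {i} (i∣p^[1+k] , i∣n) =
  prime^∤⇒coprime k pr p∤n (coprime-divisor i⊥p i∣p^[1+k] , i∣n)
  where
  i⊥p : Coprime i p
  i⊥p (j∣i , j∣p) = prime∤⇒coprime pr p∤n (j∣p , ∣-trans j∣i i∣n)

prime∣^⇒∣ : ∀ {p m} k → Prime p → p ∣ m ℕ.^ k → p ∣ m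
prime∣^⇒∣     zero    pr p∣1 = contradiction (≡.subst Prime (∣1⇒≡1 p∣1) pr) ¬prime[1]
prime∣^⇒∣ {m = m} (suc k) pr p∣m^[1+k] with euclidsLemma m _ pr p∣m^[1+k]
... | inj₁ p∣m   = p∣m
... | inj₂ p∣m^k = prime∣^⇒∣ k pr p∣m^k

prime∣prime⇒≡ : ∀ {p q} → Prime p → Prime q → p ∣ q → p ≡ q
prime∣prime⇒≡ pp pq p∣q with prime⇒irreducible pq p∣q
... | inj₁ ≡.refl = contradiction pp ¬prime[1]
... | inj₂ p≡q    = p≡q

-- Through this both the valuation at `q` and the absence of a factor `q ^ 2` pass between `m` and
-- `p ^ k * m`.
prime^∣p^k*m⇒∣m : ∀ {p q m} j k → Prime p → Prime q → q ≢ p →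
                  q ℕ.^ j ∣ p ℕ.^ k ℕ.* m → q ℕ.^ j ∣ m
prime^∣p^k*m⇒∣m j k pp pq q≢p =
  coprime-divisor (prime^∤⇒coprime j pq (q≢p ∘ prime∣prime⇒≡ pq pp ∘ prime∣^⇒∣ k pq))

-- The p-adic valuation.

largestPower-∣ : ∀ b p n → p ℕ.^ largestPower b p n ∣ n
largestPower-∣ zero    p n = 1∣ n
largestPower-∣ (suc b) p n with p ℕ.^ suc b ∣? n
... | yes p^∣n = p^∣n
... | no  _    = largestPower-∣ b p n

largestPower-max : ∀ b {p n} j → p ℕ.^ j ∣ n → j ≤ b → j ≤ largestPower b p n
largestPower-max zero            j p^j∣n j≤0 = j≤0
largestPower-max (suc b) {p} {n} j p^j∣n j≤1+b with p ℕ.^ suc b ∣? n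
... | yes _    = j≤1+b
... | no  p^∤n with ℕ.m≤n⇒m<n∨m≡n j≤1+b
...   | inj₁ (s≤s j≤b) = largestPower-max b j p^j∣n j≤b
...   | inj₂ ≡.refl    = contradiction p^j∣n p^∤n

p^ν∣n : ∀ p n → p ℕ.^ ν p n ∣ n
p^ν∣n p n = largestPower-∣ n p n

m<n^m : ∀ m n .{{_ : NonTrivial n}} → m < n ℕ.^ m
m<n^m zero    n = s≤s z≤n
m<n^m (suc m) n = begin-strict
  suc m           ≤⟨ m<n^m m n ⟩
  n ℕ.^ m         <⟨ ℕ.^-monoʳ-< n (ℕ.nonTrivial⇒n>1 n) (ℕ.n<1+n m) ⟩
  n ℕ.^ suc m     ∎
  where open ℕ.≤-Reasoning

ν-max : ∀ {p n} j → Prime p → .{{NonZero n}} → p ℕ.^ j ∣ n → j ≤ ν p n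
ν-max {p} {n} j pr p^j∣n = largestPower-max n j p^j∣n
  (ℕ.≤-trans (ℕ.<⇒≤ (m<n^m j p {{prime⇒nonTrivial pr}})) (∣⇒≤ p^j∣n))

p^k*m≢0 : ∀ {p m} k → Prime p → .{{NonZero m}} → NonZero (p ℕ.^ k ℕ.* m)
p^k*m≢0 {p} {m} k pr = ℕ.m*n≢0 (p ℕ.^ k) m
  where instance
    _ = prime⇒nonZero pr
    _ = ℕ.m^n≢0 p k

ν[p^k*m] : ∀ {p m} k → Prime p → p ∤ m → .{{NonZero m}} → ν p (p ℕ.^ k ℕ.* m) ≡ k
ν[p^k*m] {p} {m} k pr p∤m = ℕ.≤-antisym (ℕ.≮⇒≥ k≮ν) (ν-max k pr (m∣m*n m))
  where
  instance
    _ = prime⇒nonZero pr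
    _ = ℕ.m^n≢0 p k
    _ = p^k*m≢0 {m = m} k pr
  n = p ℕ.^ k ℕ.* m
  k≮ν : ¬ k < ν p n
  -- If `k < ν p n`, then `p ^ (1 + k)` divides `p ^ k * m`, and cancelling `p ^ k` leaves `p ∣ m`.
  k≮ν k<ν = p∤m (*-cancelˡ-∣ (p ℕ.^ k)
    (≡.subst (_∣ n) (ℕ.*-comm p _) (∣-trans (m≤n⇒^∣^ k<ν) (p^ν∣n p n))))
    where
    m≤n⇒^∣^ : ∀ {i j} → i ≤ j → p ℕ.^ i ∣ p ℕ.^ j
    m≤n⇒^∣^ {i} {j} i≤j = divides (p ℕ.^ (j ℕ.∸ i)) (begin
      p ℕ.^ j                            ≡⟨ ≡.cong (p ℕ.^_) (≡.sym (ℕ.m∸n+n≡m i≤j)) ⟩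
      p ℕ.^ (j ℕ.∸ i ℕ.+ i)              ≡⟨ ℕ.^-distribˡ-+-* p (j ℕ.∸ i) i ⟩
      p ℕ.^ (j ℕ.∸ i) ℕ.* p ℕ.^ i        ∎)
      where open ≡.≡-Reasoning

ν-q[p^k*m] : ∀ {p q m} k → Prime p → Prime q → q ≢ p → .{{NonZero m}} →
             ν q (p ℕ.^ k ℕ.* m) ≡ ν q m
ν-q[p^k*m] {p} {q} {m} k pp pq q≢p = ℕ.≤-antisym
  (ν-max (ν q n) pq (prime^∣p^k*m⇒∣m (ν q n) k pp pq q≢p (p^ν∣n q n)))
  (ν-max (ν q m) pq (∣n⇒∣m*n (p ℕ.^ k) (p^ν∣n q m)))
  where
  n = p ℕ.^ k ℕ.* m
  instance _ = p^k*m≢0 {m = m} k pp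

-- The list of prime divisors.

primeDivisor? : ∀ n → Decidable (λ p → Prime p × p ∣ n)
primeDivisor? n p = prime? p ×-dec (p ∣? n)

∈-primeDivisors⁺ : ∀ {q n} → Prime q → .{{NonZero n}} → q ∣ n → q ∈ primeDivisors n
∈-primeDivisors⁺ {n = n} pr q∣n = ∈-filter⁺ (primeDivisor? n) (∈-upTo⁺ (s≤s (∣⇒≤ q∣n))) (pr , q∣n)

∈-primeDivisors⁻ : ∀ {q} n → q ∈ primeDivisors n → Prime q × q ∣ n
∈-primeDivisors⁻ n q∈ = proj₂ (∈-filter⁻ (primeDivisor? n) {xs = upTo (suc n)} q∈)

primeDivisors! : ∀ n → Unique (primeDivisors n)
primeDivisors! n = filter⁺ (primeDivisor? n) (upTo⁺ (suc n))

-- The lists are increasing, so `p` may land anywhere and only a permutation can be expected. Two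
-- duplicate-free lists with the same members are permutations of each other.
primeDivisors-p^[1+k]*m : ∀ {p m} k → Prime p → p ∤ m → .{{NonZero m}} →
  primeDivisors (p ℕ.^ suc k ℕ.* m) ↭ p List.∷ primeDivisors m
primeDivisors-p^[1+k]*m {p} {m} k pr p∤m = ∼bag⇒↭ (unique∧set⇒bag
  (primeDivisors! n)
  (All.¬Any⇒All¬ _ (p∤m ∘ proj₂ ∘ ∈-primeDivisors⁻ m) AllPairs.∷ primeDivisors! m)
  (mk⇔ to from))
  where
  n = p ℕ.^ suc k ℕ.* m
  instance _ = p^k*m≢0 {m = m} (suc k) pr
  to : ∀ {q} → q ∈ primeDivisors n → q ∈ p List.∷ primeDivisors m
  to q∈ with pq , q∣n ← ∈-primeDivisors⁻ n q∈ with euclidsLemma (p ℕ.^ suc k) m pq q∣n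
  ... | inj₁ q∣p^ = here (prime∣prime⇒≡ pq pr (prime∣^⇒∣ (suc k) pq q∣p^))
  ... | inj₂ q∣m  = there (∈-primeDivisors⁺ pq q∣m)
  from : ∀ {q} → q ∈ p List.∷ primeDivisors m → q ∈ primeDivisors n
  from (here ≡.refl) = ∈-primeDivisors⁺ pr (∣m⇒∣m*n m (m∣m*n (p ℕ.^ k)))
  from (there q∈) with pq , q∣m ← ∈-primeDivisors⁻ m q∈ =
    ∈-primeDivisors⁺ pq (∣n⇒∣m*n (p ℕ.^ suc k) q∣m)

-- Induction along prime powers.

∃primeDivisor : ∀ n .{{_ : NonTrivial n}} → ∃[ p ] Prime p × p ∣ n
∃primeDivisor n with factorise n {{ℕ.nonTrivial⇒nonZero n}}
... | record { factors = [] ; isFactorisation = ≡.refl } = contradiction ≡.refl (ℕ.nonTrivial⇒≢1 {n})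
... | record { factors = p List.∷ ps ; isFactorisation = ≡.refl ; factorsPrime = pr All.∷ _ } =
  p , pr , m∣m*n _

-- Two nested inductions: well-founded recursion supplies `P m` for the part `m` of `n` prime to
-- `p`, then the power of `p` is restored one factor at a time. Keeping `P m` available throughout
-- is what the two-term recursions need.
prime-power-induction :
  ∀ {ℓ} (P : ℕ → Set ℓ) → P 1 →
  (∀ {p m} k → Prime p → p ∤ m → .{{NonZero m}} →
    P (p ℕ.^ k ℕ.* m) → P m → P (p ℕ.^ suc k ℕ.* m)) →
  ∀ n .{{_ : NonZero n}} → P n
prime-power-induction P P1 Pstep n = <-rec (λ n → .{{NonZero n}} → P n) step n
  where
  step : ∀ n → (∀ {m} → m < n → .{{NonZero m}} → P m) → .{{NonZero n}} → P n
  step 1               rec = P1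
  step n@(suc (suc _)) rec with p , pr , p∣n ← ∃primeDivisor n =
    ≡.subst P (≡.sym n≡p^v*m) (powers (ν p n))
    where
    instance
      _ = prime⇒nonTrivial pr
      _ = prime⇒nonZero pr
      _ = ℕ.m^n≢0 p (ν p n)
    m = quotient (p^ν∣n p n)
    n≡p^v*m : n ≡ p ℕ.^ ν p n ℕ.* m
    n≡p^v*m = m∣n⇒n≡m*quotient (p^ν∣n p n)
    instance _ = quotient≢0 (p^ν∣n p n)
    p∤m : p ∤ m
    p∤m p∣m = ℕ.<-irrefl ≡.refl (ν-max (suc (ν p n)) pr
      (≡.subst₂ _∣_ (ℕ.*-comm _ p) (≡.sym n≡p^v*m) (*-monoʳ-∣ (p ℕ.^ ν p n) p∣m)))
    -- The exponent is positive because `p` divides `n`; hence `m` is strictly smaller and the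
    -- recursion applies.
    1≤ν : 1 ≤ ν p n
    1≤ν = ν-max 1 pr (≡.subst (_∣ n) (≡.sym (ℕ.*-identityʳ p)) p∣n)
    m<n : m < n
    m<n = quotient-< (p^ν∣n p n)
      {{ℕ.n>1⇒nonTrivial (ℕ.≤-<-trans 1≤ν (m<n^m (ν p n) p))}}
    Pm : P m
    Pm = rec m<n
    powers : ∀ k → P (p ℕ.^ k ℕ.* m)
    powers zero    = ≡.subst P (≡.sym (ℕ.*-identityˡ m)) Pm
    powers (suc k) = Pstep k pr p∤m (powers k) Pm

-- Factor pairs of an integer.

-- The order of the list is left open, so it can be built in whatever way suits the sum taken over
-- it.
record Factorisations (n : ℕ) : Set where
  field
    pairs    : List (ℕ × ℕ)
    sound    : ∀ {d e} → (d , e) ∈ pairs → d ℕ.* e ≡ n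
    complete : ∀ {d e} → d ℕ.* e ≡ n → (d , e) ∈ pairs
    unique   : Unique pairs

open Factorisations

factorisations-1 : Factorisations 1
factorisations-1 .pairs                 = (1 , 1) List.∷ []
factorisations-1 .sound (here ≡.refl)   = ≡.refl
factorisations-1 .complete {d} {e} de≡1 =
  here (≡.cong₂ _,_ (ℕ.m*n≡1⇒m≡1 d e de≡1) (ℕ.m*n≡1⇒n≡1 d e de≡1))
factorisations-1 .unique                = [] AllPairs.∷ []

-- A divisor of p ^ (1 + k) * m is either divisible by p ^ (1 + k), or a divisor
-- of p ^ k * m; in the second case it is the cofactor that gains a factor p.
factorisations-p^[1+k]*m : ∀ {p m} k → Prime p → p ∤ m → .{{NonZero m}} →
  Factorisations (p ℕ.^ k ℕ.* m) → Factorisations m → Factorisations (p ℕ.^ suc k ℕ.* m)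
factorisations-p^[1+k]*m {p} {m} k pr p∤m F₁ F₂ = λ where
    .pairs    → List.map α (pairs F₁) ++ List.map β (pairs F₂)
    .sound    → snd
    .complete → cpl
    .unique   → ++⁺ (map⁺ α-inj (unique F₁)) (map⁺ β-inj (unique F₂)) disj
  where
  instance
    _ = prime⇒nonZero pr
    _ = ℕ.m^n≢0 p (suc k)
  α β : ℕ × ℕ → ℕ × ℕ
  α (d , e) = d , p ℕ.* e
  β (d , e) = p ℕ.^ suc k ℕ.* d , e
  α-inj : ∀ {u v} → α u ≡ α v → u ≡ v
  α-inj eq = ≡.cong₂ _,_ (,-injectiveˡ eq) (ℕ.*-cancelˡ-≡ _ _ p (,-injectiveʳ eq))
  β-inj : ∀ {u v} → β u ≡ β v → u ≡ v
  β-inj eq = ≡.cong₂ _,_ (ℕ.*-cancelˡ-≡ _ _ (p ℕ.^ suc k) (,-injectiveˡ eq)) (,-injectiveʳ eq)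
  α-* : ∀ d e → d ℕ.* (p ℕ.* e) ≡ p ℕ.* (d ℕ.* e)
  α-* d e = begin
    d ℕ.* (p ℕ.* e)   ≡⟨ ℕ.*-assoc d p e ⟨
    d ℕ.* p ℕ.* e     ≡⟨ ≡.cong (ℕ._* e) (ℕ.*-comm d p) ⟩
    p ℕ.* d ℕ.* e     ≡⟨ ℕ.*-assoc p d e ⟩
    p ℕ.* (d ℕ.* e)   ∎
    where open ≡.≡-Reasoning
  snd : ∀ {d e} → (d , e) ∈ List.map α (pairs F₁) ++ List.map β (pairs F₂) →
        d ℕ.* e ≡ p ℕ.^ suc k ℕ.* m
  snd de∈ with ∈-++⁻ (List.map α (pairs F₁)) de∈
  ... | inj₁ de∈α with (d , e) , u∈ , ≡.refl ← ∈-map⁻ α de∈α =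
    ≡.trans (α-* d e) (≡.trans (≡.cong (p ℕ.*_) (sound F₁ u∈)) (≡.sym (ℕ.*-assoc p _ m)))
  ... | inj₂ de∈β with (d , e) , u∈ , ≡.refl ← ∈-map⁻ β de∈β =
    ≡.trans (ℕ.*-assoc (p ℕ.^ suc k) d e) (≡.cong (p ℕ.^ suc k ℕ.*_) (sound F₂ u∈))
  cpl : ∀ {d e} → d ℕ.* e ≡ p ℕ.^ suc k ℕ.* m →
        (d , e) ∈ List.map α (pairs F₁) ++ List.map β (pairs F₂)
  cpl {d} {e} de≡n with p ∣? e
  ... | yes (divides e′ ≡.refl) = ∈-++⁺ˡ
    (≡.subst (λ e → (d , e) ∈ List.map α (pairs F₁)) (ℕ.*-comm p e′)
    (∈-map⁺ α (complete F₁ (ℕ.*-cancelˡ-≡ _ _ p (begin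
      p ℕ.* (d ℕ.* e′)        ≡⟨ α-* d e′ ⟨
      d ℕ.* (p ℕ.* e′)        ≡⟨ ≡.cong (d ℕ.*_) (ℕ.*-comm p e′) ⟩
      d ℕ.* (e′ ℕ.* p)        ≡⟨ de≡n ⟩
      p ℕ.^ suc k ℕ.* m       ≡⟨ ℕ.*-assoc p _ m ⟩
      p ℕ.* (p ℕ.^ k ℕ.* m)   ∎)))))
    where open ≡.≡-Reasoning
  ... | no p∤e
    with divides d′ ≡.refl ← coprime-divisor {n = e} {o = d} (prime^∤⇒coprime (suc k) pr p∤e)
           (≡.subst (p ℕ.^ suc k ∣_) (≡.trans (≡.sym de≡n) (ℕ.*-comm d e)) (m∣m*n m)) =
    ∈-++⁺ʳ (List.map α (pairs F₁))
      (≡.subst (λ d → (d , e) ∈ List.map β (pairs F₂)) (ℕ.*-comm (p ℕ.^ suc k) d′)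
      (∈-map⁺ β (complete F₂ (ℕ.*-cancelˡ-≡ _ _ (p ℕ.^ suc k) (begin
        p ℕ.^ suc k ℕ.* (d′ ℕ.* e)   ≡⟨ ℕ.*-assoc (p ℕ.^ suc k) d′ e ⟨
        p ℕ.^ suc k ℕ.* d′ ℕ.* e     ≡⟨ ≡.cong (ℕ._* e) (ℕ.*-comm (p ℕ.^ suc k) d′) ⟩
        d′ ℕ.* p ℕ.^ suc k ℕ.* e     ≡⟨ de≡n ⟩
        p ℕ.^ suc k ℕ.* m            ∎)))))
    where open ≡.≡-Reasoning
  -- In an image of `α` the second component is divisible by `p`; in an image of `β` it divides `m`.
  disj : ∀ {u} → ¬ (u ∈ List.map α (pairs F₁) × u ∈ List.map β (pairs F₂))
  disj (u∈α , u∈β) with _ , _ , ≡.refl ← ∈-map⁻ α u∈α with (d , e) , v∈ , eq ← ∈-map⁻ β u∈β =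
    p∤m (≡.subst (p ∣_) (sound F₂ v∈)
      (∣n⇒∣m*n d (≡.subst (p ∣_) (,-injectiveʳ eq) (m∣m*n _))))

module _ {a b} {A : Set a} {B : Set b} (f : A → B) where

  -- Injectivity is asked only on members: the projections of factor pairs are injective for a fixed
  -- nonzero product, not on all pairs.
  map-unique⁺ : ∀ {xs} → (∀ {x y} → x ∈ xs → y ∈ xs → f x ≡ f y → x ≡ y) →
                Unique xs → Unique (List.map f xs)
  map-unique⁺ inj []                    = []
  map-unique⁺ inj (x≢xs AllPairs.∷ xs!) =
    All.map⁺ (All.tabulate λ y∈xs fx≡fy →
      All.lookup x≢xs y∈xs (inj (here ≡.refl) (there y∈xs) fx≡fy))
    AllPairs.∷ map-unique⁺ (λ x∈ y∈ → inj (there x∈) (there y∈)) xs!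

cofactor-unique : ∀ {d e e′ n} .{{_ : NonZero n}} → d ℕ.* e ≡ n → d ℕ.* e′ ≡ n → e ≡ e′
cofactor-unique {zero}  ≡.refl _     = contradiction ≡.refl (ℕ.≢-nonZero⁻¹ 0)
cofactor-unique {suc d} de≡n de′≡n = ℕ.*-cancelˡ-≡ _ _ (suc d) (≡.trans de≡n (≡.sym de′≡n))

module _ {n : ℕ} .{{_ : NonZero n}} (F : Factorisations n) where

  pairs-injective₁ : ∀ {u v} → u ∈ pairs F → v ∈ pairs F → proj₁ u ≡ proj₁ v → u ≡ v
  pairs-injective₁ {d , _} u∈ v∈ ≡.refl = ≡.cong (d ,_) (cofactor-unique {d} (sound F u∈) (sound F v∈))

  pairs-injective₂ : ∀ {u v} → u ∈ pairs F → v ∈ pairs F → proj₂ u ≡ proj₂ v → u ≡ v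
  pairs-injective₂ {d , e} {d′ , _} u∈ v∈ ≡.refl = ≡.cong (_, e) (cofactor-unique {e}
    (≡.trans (ℕ.*-comm e d) (sound F u∈)) (≡.trans (ℕ.*-comm e d′) (sound F v∈)))

m*n≡o⇒m≢0 : ∀ m n {o} .{{_ : NonZero o}} → m ℕ.* n ≡ o → NonZero m
m*n≡o⇒m≢0 m n ≡.refl = ℕ.m*n≢0⇒m≢0 m

m*n≡o⇒n≢0 : ∀ m n {o} .{{_ : NonZero o}} → m ℕ.* n ≡ o → NonZero n
m*n≡o⇒n≢0 m n ≡.refl = ℕ.m*n≢0⇒n≢0 m

module _ {c ℓ} (R : CommutativeRing c ℓ) where

  open CommutativeRing R hiding (zero)
  open Arithmetic R hiding (Carrier; _-_; 1#)
  open SemiringSum semiring using (sum; *-distribˡ-sum; *-distribʳ-sum)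
  open CommutativeMonoidSum +-commutativeMonoid using (sum-cong-≋; sum-replicate-zero; sum-remove; ∑-comm)
  open SemiringExp semiring using (^-congˡ; ^-assocʳ)
  open CommutativeSemiringExp commutativeSemiring using (^-distrib-*)
  open NaturalCoefficients commutativeSemiring using (solve; _:=_; _:*_)
  open RingProperties ring using (-1*x≈-x; -‿distribˡ-*)
  open GroupProperties +-group using (ε⁻¹≈ε; //-rightDividesˡ)
  open import Relation.Binary.Reasoning.Setoid setoid

  -- Finite sums and their reindexing.

  ∑ : ∀ {b} {B : Set b} → List B → (B → Carrier) → Carrier
  ∑ bs ψ = List.foldr (λ b s → ψ b + s) 0# bs

  module _ {b} {B : Set b} where

    ∑-cong : ∀ (bs : List B) {φ ψ} → (∀ {b} → b ∈ bs → φ b ≈ ψ b) → ∑ bs φ ≈ ∑ bs ψ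
    ∑-cong []            φ≈ψ = refl
    ∑-cong (b List.∷ bs) φ≈ψ = +-cong (φ≈ψ (here ≡.refl)) (∑-cong bs (φ≈ψ ∘ there))

    ∑-++ : ∀ (bs cs : List B) {ψ} → ∑ (bs ++ cs) ψ ≈ ∑ bs ψ + ∑ cs ψ
    ∑-++ []            cs = sym (+-identityˡ _)
    ∑-++ (b List.∷ bs) cs = trans (+-congˡ (∑-++ bs cs)) (sym (+-assoc _ _ _))

    *-distribˡ-∑ : ∀ r (bs : List B) {ψ} → r * ∑ bs ψ ≈ ∑ bs (λ b → r * ψ b)
    *-distribˡ-∑ r []            = zeroʳ r
    *-distribˡ-∑ r (b List.∷ bs) = trans (distribˡ r _ _) (+-congˡ (*-distribˡ-∑ r bs))

    ∑-map : ∀ {a} {A : Set a} (f : A → B) as {ψ} → ∑ (List.map f as) ψ ≡ ∑ as (ψ ∘ f)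
    ∑-map f []            = ≡.refl
    ∑-map f (a List.∷ as) = ≡.cong (_ +_) (∑-map f as)

  sum-zero : ∀ {n} {φ : Vector Carrier n} → (∀ i → φ i ≈ 0#) → sum φ ≈ 0#
  sum-zero {n} φ≈0 = trans (sum-cong-≋ φ≈0) (sum-replicate-zero n)

  -- Turns a sum over the indices of S into a divisor sum: `hit` places each term of the list at an
  -- index, and `miss` makes all other indices contribute 0. The induction removes the index
  -- carrying the head of the list.
  sum-reindex : ∀ {a b} {A : Set a} {B : Set b} {n}
    {x : Vector A n} → Injective _≡_ _≡_ x →
    (π : B → A) (bs : List B) → Unique (List.map π bs) →
    ∀ {φ : Vector Carrier n} {ψ : B → Carrier} →
    (∀ {b} → b ∈ bs → ∃[ i ] x i ≡ π b × φ i ≈ ψ b) →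
    (∀ i → x i ∉ List.map π bs → φ i ≈ 0#) →
    sum φ ≈ ∑ bs ψ
  sum-reindex x-inj π [] [] hit miss = sum-zero (λ i → miss i λ ())
  sum-reindex {n = zero} x-inj π (b List.∷ bs) πb! hit miss with () ← proj₁ (hit (here ≡.refl))
  sum-reindex {n = suc n} {x} x-inj π (b List.∷ bs) (πb∉ AllPairs.∷ πbs!) {φ} {ψ} hit miss
    with i , xi≡πb , φi≈ψb ← hit (here ≡.refl) = begin
      sum φ                      ≈⟨ sum-remove {i = i} φ ⟩
      φ i + sum (removeAt φ i)
        ≈⟨ +-cong φi≈ψb (sum-reindex (punchIn-injective i _ _ ∘ x-inj) π bs πbs! hit′ miss′) ⟩
      ψ b + ∑ bs ψ               ∎
    where
    hit′ : ∀ {b′} → b′ ∈ bs → ∃[ j ] x (punchIn i j) ≡ π b′ × φ (punchIn i j) ≈ ψ b′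
    hit′ b′∈ with j , xj≡ , φj≈ ← hit (there b′∈) =
      punchOut i≢j ,
      ≡.trans (≡.cong x (punchIn-punchOut i≢j)) xj≡ ,
      trans (reflexive (≡.cong φ (punchIn-punchOut i≢j))) φj≈
      where
      i≢j : i ≢ j
      -- An index serving both `b` and a later `b′` would repeat a label, against uniqueness of
      -- `List.map π`.
      i≢j ≡.refl = All.lookup πb∉ (∈-map⁺ π b′∈) (≡.trans (≡.sym xi≡πb) xj≡)
    miss′ : ∀ j → x (punchIn i j) ∉ List.map π bs → φ (punchIn i j) ≈ 0#
    miss′ j x∉ = miss (punchIn i j) λ where
      (here x≡πb) → contradiction (x-inj (≡.trans x≡πb (≡.sym xi≡πb))) (punchInᵢ≢i i j)
      (there x∈)  → x∉ x∈

  -- Diagonal matrices and the convolution unit.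

  diag-cong : ∀ {n} {u v : Vector Carrier n} → (∀ i → u i ≈ v i) → diag u ≈ᴹ diag v
  diag-cong u≈v i j with does (i ≟ᶠ j)
  ... | true  = u≈v i
  ... | false = refl

  diag-1∷-cong : ∀ {n} {u v : Vector Carrier n} → (∀ i → u i ≈ v i) → diag (1# ∷ u) ≈ᴹ diag (1# ∷ v)
  diag-1∷-cong u≈v = diag-cong λ where
    zero    → refl
    (suc i) → u≈v i

  -- The unit of Dirichlet convolution.
  δ : ℕ → Carrier
  δ n = if does (n ℕ.≟ 1) then 1# else 0#

  δ-≢1 : ∀ n → n ≢ 1 → δ n ≡ 0#
  δ-≢1 n n≢1 rewrite dec-false (n ℕ.≟ 1) n≢1 = ≡.refl

  Id : ∀ {n} → Matrix n
  Id = diag (const 1#)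

  Id-≡ : ∀ {n} (i j : Fin n) → i ≡ j → Id i j ≡ 1#
  Id-≡ i j i≡j rewrite dec-true (i ≟ᶠ j) i≡j = ≡.refl

  Id-≢ : ∀ {n} (i j : Fin n) → i ≢ j → Id i j ≡ 0#
  Id-≢ i j i≢j rewrite dec-false (i ≟ᶠ j) i≢j = ≡.refl

  sum-Idˡ : ∀ {n} i (v : Vector Carrier n) → sum (λ d → Id d i * v d) ≈ v i
  sum-Idˡ i v = trans
    (sum-reindex {x = λ d → d} (λ eq → eq) (λ d → d) (i List.∷ []) ([] AllPairs.∷ []) hit miss)
    (+-identityʳ (v i))
    where
    hit : ∀ {d} → d ∈ i List.∷ [] → ∃[ e ] e ≡ d × Id e i * v e ≈ v d
    hit (here ≡.refl) = i , ≡.refl , trans (*-congʳ (reflexive (Id-≡ i i ≡.refl))) (*-identityˡ (v i))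
    miss : ∀ d → d ∉ List.map (λ d → d) (i List.∷ []) → Id d i * v d ≈ 0#
    miss d d∉ = trans (*-congʳ (reflexive (Id-≢ d i (d∉ ∘ here)))) (zeroˡ (v d))

  -- Evaluating a Dirichlet convolution.

  -- `g p k` is the value of `h` at `p ^ (1 + k)`. `G-step` mirrors the split of the factor pairs
  -- `(d , e)`: those with `p ∣ e` give `H p` times the sum for `p ^ k * m`, and in the others `d`
  -- absorbs all of `p ^ (1 + k)`, which gives `g p k` times the sum for `m`.
  module Dirichlet
    {h H G : ℕ → Carrier} {g : ℕ → ℕ → Carrier}
    (h-1 : h 1 ≈ 1#)
    (h-step : ∀ {p d} k → Prime p → p ∤ d → .{{NonZero d}} → h (p ℕ.^ suc k ℕ.* d) ≈ g p k * h d)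
    (H-mult : CompletelyMultiplicative H)
    (G-1 : G 1 ≈ 1#)
    (G-step : ∀ {p m} k → Prime p → p ∤ m → .{{NonZero m}} →
              G (p ℕ.^ suc k ℕ.* m) ≈ H p * G (p ℕ.^ k ℕ.* m) + g p k * G m)
    where

    private
      ψ : ℕ × ℕ → Carrier
      ψ (d , e) = h d * H e

    convolution : ∀ n .{{_ : NonZero n}} → Σ[ F ∈ Factorisations n ] ∑ (pairs F) ψ ≈ G n
    convolution = prime-power-induction _ base step
      where
      base : Σ[ F ∈ Factorisations 1 ] ∑ (pairs F) ψ ≈ G 1
      base = factorisations-1 , (begin
        h 1 * H 1 + 0#   ≈⟨ +-identityʳ _ ⟩
        h 1 * H 1        ≈⟨ *-cong h-1 (proj₁ H-mult) ⟩
        1# * 1#          ≈⟨ *-identityˡ 1# ⟩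
        1#               ≈⟨ G-1 ⟨
        G 1              ∎)
      step : ∀ {p m} k → Prime p → p ∤ m → .{{NonZero m}} →
        Σ[ F ∈ Factorisations (p ℕ.^ k ℕ.* m) ] ∑ (pairs F) ψ ≈ G (p ℕ.^ k ℕ.* m) →
        Σ[ F ∈ Factorisations m ] ∑ (pairs F) ψ ≈ G m →
        Σ[ F ∈ Factorisations (p ℕ.^ suc k ℕ.* m) ] ∑ (pairs F) ψ ≈ G (p ℕ.^ suc k ℕ.* m)
      step {p} {m} k pr p∤m (F₁ , eq₁) (F₂ , eq₂) = F , (begin
        ∑ (pairs F) ψ
          ≈⟨ ∑-++ (List.map α (pairs F₁)) (List.map β (pairs F₂)) ⟩
        ∑ (List.map α (pairs F₁)) ψ + ∑ (List.map β (pairs F₂)) ψ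
          ≡⟨ ≡.cong₂ _+_ (∑-map α (pairs F₁)) (∑-map β (pairs F₂)) ⟩
        ∑ (pairs F₁) (ψ ∘ α) + ∑ (pairs F₂) (ψ ∘ β)
          ≈⟨ +-cong (∑-cong (pairs F₁) ψ∘α) (∑-cong (pairs F₂) ψ∘β) ⟩
        ∑ (pairs F₁) (λ u → H p * ψ u) + ∑ (pairs F₂) (λ u → g p k * ψ u)
          ≈⟨ +-cong (*-distribˡ-∑ (H p) (pairs F₁)) (*-distribˡ-∑ (g p k) (pairs F₂)) ⟨
        H p * ∑ (pairs F₁) ψ + g p k * ∑ (pairs F₂) ψ
          ≈⟨ +-cong (*-congˡ eq₁) (*-congˡ eq₂) ⟩
        H p * G (p ℕ.^ k ℕ.* m) + g p k * G m
          ≈⟨ G-step k pr p∤m ⟨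
        G (p ℕ.^ suc k ℕ.* m) ∎)
        where
        F = factorisations-p^[1+k]*m k pr p∤m F₁ F₂
        -- These agree definitionally with the maps that build `F`, so `pairs F` unfolds to a
        -- concatenation.
        α β : ℕ × ℕ → ℕ × ℕ
        α (d , e) = d , p ℕ.* e
        β (d , e) = p ℕ.^ suc k ℕ.* d , e
        ψ∘α : ∀ {u} → u ∈ pairs F₁ → ψ (α u) ≈ H p * ψ u
        ψ∘α {d , e} u∈ = begin
          h d * H (p ℕ.* e)     ≈⟨ *-congˡ (proj₂ H-mult p e) ⟩
          h d * (H p * H e)     ≈⟨ solve 3 (λ x y z → x :* (y :* z) := y :* (x :* z)) refl (h d) (H p) (H e) ⟩
          H p * (h d * H e)     ∎
          where instance
            _ = prime⇒nonZero pr
            _ = p^k*m≢0 {m = m} k pr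
            _ = m*n≡o⇒n≢0 d e (sound F₁ u∈)
        ψ∘β : ∀ {u} → u ∈ pairs F₂ → ψ (β u) ≈ g p k * ψ u
        ψ∘β {d , e} u∈ = trans (*-congʳ (h-step k pr p∤d)) (*-assoc _ _ _)
          where
          instance _ = m*n≡o⇒m≢0 d e (sound F₂ u∈)
          p∤d : p ∤ d
          p∤d p∣d = p∤m (≡.subst (p ∣_) (sound F₂ u∈) (∣m⇒∣m*n e p∣d))

  -- Diagonalisation by an inverse pair of divisibility matrices.

  module _ {n} (g : ℕ → Carrier) (x : Vector ℕ n) where

    quotientMatrix-∣ : ∀ {i j} q .{{_ : NonZero (x i)}} → q ℕ.* x i ≡ x j →
                       quotientMatrix g x i j ≡ g q
    quotientMatrix-∣ {i} {j} q q*xi≡xj with x i ∣? x j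
    ... | yes (divides r xj≡r*xi) = ≡.cong g (ℕ.*-cancelʳ-≡ r q (x i) (≡.sym (≡.trans q*xi≡xj xj≡r*xi)))
    ... | no  xi∤xj               = contradiction (divides q (≡.sym q*xi≡xj)) xi∤xj

    quotientMatrix-∤ : ∀ {i j} → x i ∤ x j → quotientMatrix g x i j ≡ 0#
    quotientMatrix-∤ {i} {j} xi∤xj with x i ∣? x j
    ... | yes xi∣xj = contradiction xi∣xj xi∤xj
    ... | no  _     = ≡.refl

  module Diagonalisation
    {n} {x : Vector ℕ n} (x≢0 : ∀ i → NonZero (x i))
    (x-inj : Injective _≡_ _≡_ x) (closed : FactorClosed x)
    {θ β h G : ℕ → Carrier}
    (θ-mult : CompletelyMultiplicative θ)
    (β*θ≈δ : ∀ n .{{_ : NonZero n}} →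
      Σ[ F ∈ Factorisations n ] ∑ (pairs F) (λ (d , e) → β d * θ e) ≈ δ n)
    (h*θ²≈G : ∀ n .{{_ : NonZero n}} →
      Σ[ F ∈ Factorisations n ] ∑ (pairs F) (λ (d , e) → h d * (θ e * θ e)) ≈ G n)
    where

    private
      Eᶿ Bᵝ : Matrix n
      Eᶿ = quotientMatrix θ x
      Bᵝ = quotientMatrix β x

      instance
        x≢0′ : ∀ {i} → NonZero (x i)
        x≢0′ {i} = x≢0 i

    -- Entry (i, j) runs over the chains `x i ∣ x k ∣ x j`. Writing `x j = q * x i` and
    -- `x k = d * x i` turns it into the sum of `β e * θ d` over `e * d = q`, which is `δ q`.
    E*B≈Id : Eᶿ *ᴹ Bᵝ ≈ᴹ Id
    E*B≈Id i j with x i ∣? x j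
    ... | no xi∤xj = trans (sum-zero zero-term)
      (reflexive (≡.sym (Id-≢ i j λ { ≡.refl → xi∤xj ∣-refl })))
      where
      zero-term : ∀ k → Eᶿ i k * Bᵝ k j ≈ 0#
      zero-term k with x i ∣? x k
      ... | no  _     = zeroˡ _
      ... | yes xi∣xk = trans
        (*-congˡ (reflexive (quotientMatrix-∤ β x (xi∤xj ∘ ∣-trans xi∣xk)))) (zeroʳ _)
    ... | yes xi∣xj@(divides q xj≡q*xi) = begin
      sum (λ k → Eᶿ i k * Bᵝ k j)             ≈⟨ sum-reindex x-inj π (pairs F) π! hit miss ⟩
      ∑ (pairs F) (λ (e , d) → β e * θ d)     ≈⟨ F≈δ ⟩
      δ q                                     ≡⟨ δ≡Id ⟩
      Id i j                                  ∎
      where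
      instance _ = quotient≢0 xi∣xj
      F = proj₁ (β*θ≈δ q)
      F≈δ = proj₂ (β*θ≈δ q)
      π : ℕ × ℕ → ℕ
      π (e , d) = d ℕ.* x i
      π! : Unique (List.map π (pairs F))
      π! = map-unique⁺ π
        (λ u∈ v∈ πu≡πv → pairs-injective₂ F u∈ v∈ (ℕ.*-cancelʳ-≡ _ _ (x i) πu≡πv)) (unique F)
      π-cofactor : ∀ {e d} → (e , d) ∈ pairs F → e ℕ.* (d ℕ.* x i) ≡ x j
      π-cofactor {e} {d} u∈ = ≡.trans (≡.sym (ℕ.*-assoc e d (x i)))
        (≡.trans (≡.cong (ℕ._* x i) (sound F u∈)) (≡.sym xj≡q*xi))
      hit : ∀ {u} → u ∈ pairs F → ∃[ k ] x k ≡ π u × Eᶿ i k * Bᵝ k j ≈ β (proj₁ u) * θ (proj₂ u)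
      -- Factor closure enters here: `d * x i` divides `x j`, so it is some `x k`.
      hit {e , d} u∈ with k , xk≡ ← closed j (d ℕ.* x i) (divides e (≡.sym (π-cofactor u∈))) =
        k , xk≡ , trans
          (reflexive (≡.cong₂ _*_ (quotientMatrix-∣ θ x d (≡.sym xk≡))
                                  (quotientMatrix-∣ β x e (≡.trans (≡.cong (e ℕ.*_) xk≡) (π-cofactor u∈)))))
          (*-comm _ _)
      miss : ∀ k → x k ∉ List.map π (pairs F) → Eᶿ i k * Bᵝ k j ≈ 0#
      miss k xk∉ with x i ∣? x k
      ... | no _ = zeroˡ _
      ... | yes (divides d xk≡d*xi) with x k ∣? x j
      ...   | no _ = zeroʳ _
      ...   | yes (divides e xj≡e*xk) = contradiction
        (≡.subst (_∈ List.map π (pairs F)) (≡.sym xk≡d*xi) (∈-map⁺ π (complete F {e} {d} e*d≡q))) xk∉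
        where
        e*d≡q : e ℕ.* d ≡ q
        e*d≡q = ℕ.*-cancelʳ-≡ _ _ (x i) (≡.trans (ℕ.*-assoc e d (x i))
          (≡.trans (≡.cong (e ℕ.*_) (≡.sym xk≡d*xi)) (≡.trans (≡.sym xj≡e*xk) xj≡q*xi)))
      -- `q = 1` means `x i = x j`, hence `i = j` by distinctness.
      δ≡Id : δ q ≡ Id i j
      δ≡Id with q ℕ.≟ 1
      ... | yes ≡.refl = ≡.sym (Id-≡ i j (x-inj (≡.sym (≡.trans xj≡q*xi (ℕ.*-identityˡ (x i))))))
      ... | no  q≢1    = ≡.trans (δ-≢1 q q≢1) (≡.sym (Id-≢ i j λ { ≡.refl → q≢1
        (ℕ.*-cancelʳ-≡ q 1 (x i) (≡.trans (≡.sym xj≡q*xi) (≡.sym (ℕ.*-identityˡ (x i))))) }))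

    module _
      {M : Matrix n}
      (M≈θθG : ∀ i j k l → k ℕ.* gcd (x i) (x j) ≡ x i → l ℕ.* gcd (x i) (x j) ≡ x j →
               M i j ≈ θ k * θ l * G (gcd (x i) (x j)))
      where

      -- The surviving indices are the common divisors of `x i` and `x j`, that is, the divisors `d`
      -- of `g`. With `g = d * e` the quotients are `k * e` and `l * e`, so `θ k * θ l` comes out
      -- and `θ e` remains squared.
      M≈EᵀhE : ∀ i j → M i j ≈ sum (λ d → Eᶿ d i * (Eᶿ d j * h (x d)))
      M≈EᵀhE i j = sym (begin
        sum (λ d → Eᶿ d i * (Eᶿ d j * h (x d)))
          ≈⟨ sum-reindex x-inj proj₁ (pairs F)
               (map-unique⁺ proj₁ (pairs-injective₁ F) (unique F)) hit miss ⟩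
        ∑ (pairs F) (λ (d , e) → θ k * θ l * (h d * (θ e * θ e)))
          ≈⟨ *-distribˡ-∑ (θ k * θ l) (pairs F) ⟨
        θ k * θ l * ∑ (pairs F) (λ (d , e) → h d * (θ e * θ e))
          ≈⟨ *-congˡ F≈G ⟩
        θ k * θ l * G g
          ≈⟨ M≈θθG i j k l (≡.sym xi≡k*g) (≡.sym xj≡l*g) ⟨
        M i j ∎)
        where
        g = gcd (x i) (x j)
        g∣xi = gcd[m,n]∣m (x i) (x j)
        g∣xj = gcd[m,n]∣n (x i) (x j)
        k = quotient g∣xi
        l = quotient g∣xj
        xi≡k*g : x i ≡ k ℕ.* g
        xi≡k*g = m∣n⇒n≡quotient*m g∣xi
        xj≡l*g : x j ≡ l ℕ.* g
        xj≡l*g = m∣n⇒n≡quotient*m g∣xj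
        instance
          g≢0 : NonZero g
          g≢0 = ℕ.≢-nonZero (gcd[m,n]≢0 (x i) (x j) (inj₁ (ℕ.≢-nonZero⁻¹ (x i))))
          k≢0 : NonZero k
          k≢0 = quotient≢0 g∣xi
          l≢0 : NonZero l
          l≢0 = quotient≢0 g∣xj
        F = proj₁ (h*θ²≈G g)
        F≈G = proj₂ (h*θ²≈G g)
        hit : ∀ {u} → u ∈ pairs F → ∃[ t ] x t ≡ proj₁ u ×
              Eᶿ t i * (Eᶿ t j * h (x t)) ≈ θ k * θ l * (h (proj₁ u) * (θ (proj₂ u) * θ (proj₂ u)))
        hit {d , e} u∈ with t , ≡.refl ← closed i d (∣-trans (≡.subst (d ∣_) (sound F u∈) (m∣m*n e)) g∣xi) =
          t , ≡.refl , (begin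
            Eᶿ t i * (Eᶿ t j * h d)
              ≡⟨ ≡.cong₂ (λ y z → y * (z * h d)) (quotientMatrix-∣ θ x (k ℕ.* e) (cofactor k xi≡k*g))
                                                 (quotientMatrix-∣ θ x (l ℕ.* e) (cofactor l xj≡l*g)) ⟩
            θ (k ℕ.* e) * (θ (l ℕ.* e) * h d)
              ≈⟨ *-cong (proj₂ θ-mult k e) (*-congʳ (proj₂ θ-mult l e)) ⟩
            θ k * θ e * (θ l * θ e * h d)
              ≈⟨ solve 4 (λ y z v w → y :* v :* (z :* v :* w) := y :* z :* (w :* (v :* v)))
                   refl (θ k) (θ l) (θ e) (h d) ⟩
            θ k * θ l * (h d * (θ e * θ e)) ∎)
          where
          instance _ = m*n≡o⇒n≢0 d e (sound F u∈)
          cofactor : ∀ k {y} → y ≡ k ℕ.* g → k ℕ.* e ℕ.* d ≡ y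
          cofactor k y≡k*g = ≡.trans (ℕ.*-assoc k e d) (≡.trans
            (≡.cong (k ℕ.*_) (≡.trans (ℕ.*-comm e d) (sound F u∈))) (≡.sym y≡k*g))
        miss : ∀ t → x t ∉ List.map proj₁ (pairs F) → Eᶿ t i * (Eᶿ t j * h (x t)) ≈ 0#
        miss t xt∉ with x t ∣? x i
        ... | no _ = zeroˡ _
        ... | yes xt∣xi with x t ∣? x j
        ...   | no _ = trans (*-congˡ (zeroˡ _)) (zeroʳ _)
        ...   | yes xt∣xj = contradiction
          (∈-map⁺ proj₁ (complete F (≡.sym (m∣n⇒n≡m*quotient (gcd-greatest xt∣xi xt∣xj))))) xt∉

      -- After exchanging the sums, the inner one is entry (d, i) of `Eᶿ *ᴹ Bᵝ`, which leaves only
      -- `d = i`.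
      BᵀM≈hE : ∀ i l → (Bᵝ ᵀ *ᴹ M) i l ≈ Eᶿ i l * h (x i)
      BᵀM≈hE i l = begin
        sum (λ k → Bᵝ k i * M k l)
          ≈⟨ sum-cong-≋ (λ k → trans (*-congˡ (M≈EᵀhE k l))
               (*-distribˡ-sum (Bᵝ k i) (λ d → Eᶿ d k * (Eᶿ d l * h (x d))))) ⟩
        sum (λ k → sum (λ d → Bᵝ k i * (Eᶿ d k * (Eᶿ d l * h (x d)))))
          ≈⟨ ∑-comm (λ k d → Bᵝ k i * (Eᶿ d k * (Eᶿ d l * h (x d)))) ⟩
        sum (λ d → sum (λ k → Bᵝ k i * (Eᶿ d k * (Eᶿ d l * h (x d)))))
          ≈⟨ sum-cong-≋ (λ d → sum-cong-≋ (λ k →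
               solve 3 (λ u v w → u :* (v :* w) := v :* u :* w)
                 refl (Bᵝ k i) (Eᶿ d k) (Eᶿ d l * h (x d)))) ⟩
        sum (λ d → sum (λ k → Eᶿ d k * Bᵝ k i * (Eᶿ d l * h (x d))))
          ≈⟨ sum-cong-≋ (λ d → trans
               (sym (*-distribʳ-sum (Eᶿ d l * h (x d)) (λ k → Eᶿ d k * Bᵝ k i)))
               (*-congʳ (E*B≈Id d i))) ⟩
        sum (λ d → Id d i * (Eᶿ d l * h (x d)))
          ≈⟨ sum-Idˡ i (λ d → Eᶿ d l * h (x d)) ⟩
        Eᶿ i l * h (x i) ∎

      BᵀMB≈diag : Bᵝ ᵀ *ᴹ M *ᴹ Bᵝ ≈ᴹ diag (h ∘ x)
      BᵀMB≈diag i j = begin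
        sum (λ l → (Bᵝ ᵀ *ᴹ M) i l * Bᵝ l j)
          ≈⟨ sum-cong-≋ (λ l → trans (*-congʳ (BᵀM≈hE i l))
               (solve 3 (λ u v w → u :* v :* w := v :* (u :* w)) refl (Eᶿ i l) (h (x i)) (Bᵝ l j))) ⟩
        sum (λ l → h (x i) * (Eᶿ i l * Bᵝ l j))
          ≈⟨ *-distribˡ-sum (h (x i)) (λ l → Eᶿ i l * Bᵝ l j) ⟨
        h (x i) * sum (λ l → Eᶿ i l * Bᵝ l j)
          ≈⟨ *-congˡ (E*B≈Id i j) ⟩
        h (x i) * Id i j
          ≈⟨ h*Id ⟩
        diag (h ∘ x) i j ∎
        where
        h*Id : h (x i) * Id i j ≈ diag (h ∘ x) i j
        h*Id with does (i ≟ᶠ j)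
        ... | true  = *-identityʳ _
        ... | false = zeroʳ _

  -- Products over prime divisors.

  ∏-cong : ∀ ps {t u : ℕ → Carrier} → (∀ {p} → p ∈ ps → t p ≈ u p) →
           List.foldr _*_ 1# (List.map t ps) ≈ List.foldr _*_ 1# (List.map u ps)
  ∏-cong []             t≈u = refl
  ∏-cong (p List.∷ ps)  t≈u = *-cong (t≈u (here ≡.refl)) (∏-cong ps (t≈u ∘ there))

  -- The multiplicative function with value `t p v` at `p ^ v` for `v ≥ 1`. Every diagonal in the
  -- theorem has this form.
  primeProduct : (ℕ → ℕ → Carrier) → ℕ → Carrier
  primeProduct t n = ∏[p∣ n ] λ p → t p (ν p n)

  primeProduct-cong : ∀ {t u} → (∀ {p} v → Prime p → t p v ≈ u p v) →
                      ∀ n → primeProduct t n ≈ primeProduct u n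
  primeProduct-cong t≈u n =
    ∏-cong (primeDivisors n) (λ {p} p∈ → t≈u (ν p n) (proj₁ (∈-primeDivisors⁻ n p∈)))

  primeProduct-p^[1+k]*m : ∀ t {p m} k → Prime p → p ∤ m → .{{NonZero m}} →
    primeProduct t (p ℕ.^ suc k ℕ.* m) ≈ t p (suc k) * primeProduct t m
  primeProduct-p^[1+k]*m t {p} {m} k pr p∤m = begin
    ∏[p∣ n ] (λ q → t q (ν q n))
      ≈⟨ Permutation.foldr-commMonoid setoid *-isCommutativeMonoid
           (↭⇒↭ₛ′ isEquivalence (↭-map⁺ _ (primeDivisors-p^[1+k]*m k pr p∤m))) ⟩
    t p (ν p n) * ∏[p∣ m ] (λ q → t q (ν q n))
      ≈⟨ *-cong (reflexive (≡.cong (t p) (ν[p^k*m] (suc k) pr p∤m)))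
                (∏-cong (primeDivisors m) same-ν) ⟩
    t p (suc k) * primeProduct t m ∎
    where
    n = p ℕ.^ suc k ℕ.* m
    same-ν : ∀ {q} → q ∈ primeDivisors m → t q (ν q n) ≈ t q (ν q m)
    same-ν {q} q∈ with pq , q∣m ← ∈-primeDivisors⁻ m q∈ =
      reflexive (≡.cong (t q) (ν-q[p^k*m] (suc k) pr pq (λ { ≡.refl → p∤m q∣m })))

  -- The Möbius function.

  -- The test inside `μ` looks only at prime divisors of `n`, but a prime whose square divides `n`
  -- is one of them.
  μ-square∣ : ∀ {q n} → Prime q → .{{NonZero n}} → q ℕ.^ 2 ∣ n → μ n ≡ 0#
  μ-square∣ {q} {n} pq q²∣n
    rewrite dec-true (any? (λ p → p ℕ.^ 2 ∣? n) (primeDivisors n))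
      (lose (∈-primeDivisors⁺ pq (m*n∣⇒m∣ q _ q²∣n)) q²∣n) = ≡.refl

  μ-squarefree : ∀ {n} → (∀ {q} → Prime q → q ℕ.^ 2 ∤ n) → μ n ≡ (- 1#) ^ length (primeDivisors n)
  μ-squarefree {n} sqf
    rewrite dec-false (any? (λ p → p ℕ.^ 2 ∣? n) (primeDivisors n))
      (λ ∃q → let q , q∈ , q²∣n = find ∃q in sqf (proj₁ (∈-primeDivisors⁻ n q∈)) q²∣n) = ≡.refl

  squareDivisor? : ∀ n .{{_ : NonZero n}} →
    (∃[ q ] Prime q × q ℕ.^ 2 ∣ n) ⊎ (∀ {q} → Prime q → q ℕ.^ 2 ∤ n)
  squareDivisor? n with any? (λ q → q ℕ.^ 2 ∣? n) (primeDivisors n)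
  ... | yes ∃q = let q , q∈ , q²∣n = find ∃q in inj₁ (q , proj₁ (∈-primeDivisors⁻ n q∈) , q²∣n)
  ... | no  ∄q = inj₂ λ {q} pq q²∣n → ∄q (lose (∈-primeDivisors⁺ pq (m*n∣⇒m∣ q _ q²∣n)) q²∣n)

  -- `p ^ 2` does not divide `p * m`, and squares of other primes divide `p * m` exactly when they
  -- divide `m`. So either both values vanish, or one more prime changes the sign.
  μ-p*m : ∀ {p m} → Prime p → p ∤ m → .{{NonZero m}} → μ (p ℕ.^ 1 ℕ.* m) ≈ - μ m
  μ-p*m {p} {m} pr p∤m = helper (squareDivisor? m)
    where
    instance
      _ = prime⇒nonZero pr
      _ = p^k*m≢0 {m = m} 1 pr
    n = p ℕ.^ 1 ℕ.* m
    p²∤n : p ℕ.^ 2 ∤ n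
    p²∤n p²∣n = p∤m (*-cancelˡ-∣ p
      (≡.subst₂ _∣_ (≡.cong (p ℕ.*_) (ℕ.*-identityʳ p)) (≡.cong (ℕ._* m) (ℕ.*-identityʳ p)) p²∣n))
    helper : (∃[ q ] Prime q × q ℕ.^ 2 ∣ m) ⊎ (∀ {q} → Prime q → q ℕ.^ 2 ∤ m) → μ n ≈ - μ m
    helper (inj₁ (q , pq , q²∣m)) = begin
      μ n     ≡⟨ μ-square∣ pq (∣n⇒∣m*n (p ℕ.^ 1) q²∣m) ⟩
      0#      ≈⟨ ε⁻¹≈ε ⟨
      - 0#    ≡⟨ ≡.cong -_ (μ-square∣ pq q²∣m) ⟨
      - μ m   ∎
    helper (inj₂ sqf) = begin
      μ n                                       ≡⟨ μ-squarefree sqf′ ⟩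
      (- 1#) ^ length (primeDivisors n)         ≡⟨ ≡.cong ((- 1#) ^_) (↭-length (primeDivisors-p^[1+k]*m 0 pr p∤m)) ⟩
      - 1# * (- 1#) ^ length (primeDivisors m)  ≈⟨ -1*x≈-x _ ⟩
      - (- 1#) ^ length (primeDivisors m)       ≡⟨ ≡.cong -_ (μ-squarefree sqf) ⟨
      - μ m                                     ∎
      where
      sqf′ : ∀ {q} → Prime q → q ℕ.^ 2 ∤ n
      sqf′ {q} pq q²∣n with q ℕ.≟ p
      ... | yes ≡.refl = p²∤n q²∣n
      ... | no  q≢p    = sqf pq (prime^∣p^k*m⇒∣m 2 1 pr pq q≢p q²∣n)

  -- Closure properties of multiplicative functions.

  *-pres-CompletelyMultiplicative : ∀ {f g} → CompletelyMultiplicative f → CompletelyMultiplicative g →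
                                    CompletelyMultiplicative (λ n → f n * g n)
  *-pres-CompletelyMultiplicative (f1 , f*) (g1 , g*) =
    trans (*-cong f1 g1) (*-identityˡ 1#) ,
    λ m n → trans (*-cong (f* m n) (g* m n))
      (solve 4 (λ s t u v → s :* t :* (u :* v) := s :* u :* (t :* v)) refl _ _ _ _)

  1-completelyMultiplicative : CompletelyMultiplicative (const 1#)
  1-completelyMultiplicative = refl , λ _ _ → sym (*-identityˡ 1#)

  1^n≈1 : ∀ n → 1# ^ n ≈ 1#
  1^n≈1 zero    = refl
  1^n≈1 (suc n) = trans (*-identityˡ _) (1^n≈1 n)

  ^-pres-Multiplicative : ∀ {f} a → Multiplicative f → Multiplicative (λ n → f n ^ a)
  ^-pres-Multiplicative a (f1 , f*) =
    trans (^-congˡ a f1) (1^n≈1 a) ,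
    λ m n m⊥n → trans (^-congˡ a (f* m n m⊥n)) (^-distrib-* _ _ a)

  ^-pres-CompletelyMultiplicative : ∀ {f} a → CompletelyMultiplicative f →
                                    CompletelyMultiplicative (λ n → f n ^ a)
  ^-pres-CompletelyMultiplicative a (f1 , f*) =
    trans (^-congˡ a f1) (1^n≈1 a) ,
    λ m n → trans (^-congˡ a (f* m n)) (^-distrib-* _ _ a)

  completelyMultiplicative⇒multiplicative : ∀ {f} → CompletelyMultiplicative f → Multiplicative f
  completelyMultiplicative⇒multiplicative (f1 , f*) = f1 , λ m n _ → f* m n

  completelyMultiplicative-^ : ∀ {f} → CompletelyMultiplicative f →
                               ∀ p k .{{_ : NonZero p}} → f (p ℕ.^ k) ≈ f p ^ k
  completelyMultiplicative-^ (f1 , f*) p zero    = f1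
  completelyMultiplicative-^ f-mult    p (suc k) =
    trans (proj₂ f-mult p (p ℕ.^ k)) (*-congˡ (completelyMultiplicative-^ f-mult p k))
    where instance _ = ℕ.m^n≢0 p k

  -- Twisted Möbius inversion.

  module _ {θ β : ℕ → Carrier} (θ-mult : CompletelyMultiplicative θ) (β≈μθ : ∀ n → β n ≈ μ n * θ n) where

    private
      -- The value of `μ * θ` at `p ^ (1 + k)`.
      γ : ℕ → ℕ → Carrier
      γ p zero    = - θ p
      γ p (suc k) = 0#

    -- `β` is tied to `μ * θ` only by an equation, so that the entries of `B`, which are `μ` itself,
    -- fit the case θ = 1.
    möbius-inversion : ∀ n .{{_ : NonZero n}} →
      Σ[ F ∈ Factorisations n ] ∑ (pairs F) (λ (d , e) → β d * θ e) ≈ δ n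
    möbius-inversion = Dirichlet.convolution β-1 β-step θ-mult refl δ-step
      where
      β-1 : β 1 ≈ 1#
      β-1 = trans (β≈μθ 1) (trans (*-identityˡ _) (proj₁ θ-mult))
      β-step : ∀ {p d} k → Prime p → p ∤ d → .{{NonZero d}} → β (p ℕ.^ suc k ℕ.* d) ≈ γ p k * β d
      β-step {p} {d} zero pr p∤d = begin
        β (p ℕ.^ 1 ℕ.* d)                    ≈⟨ β≈μθ _ ⟩
        μ (p ℕ.^ 1 ℕ.* d) * θ (p ℕ.^ 1 ℕ.* d) ≈⟨ *-cong (μ-p*m pr p∤d) θ[p*d] ⟩
        - μ d * (θ p * θ d)                  ≈⟨ -‿distribˡ-* _ _ ⟨
        - (μ d * (θ p * θ d))                ≈⟨ -‿cong (solve 3 (λ u v w → u :* (v :* w) := v :* (u :* w))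
                                                            refl (μ d) (θ p) (θ d)) ⟩
        - (θ p * (μ d * θ d))                ≈⟨ -‿distribˡ-* _ _ ⟩
        - θ p * (μ d * θ d)                  ≈⟨ *-congˡ (β≈μθ d) ⟨
        - θ p * β d                          ∎
        where
        instance _ = prime⇒nonZero pr
        θ[p*d] : θ (p ℕ.^ 1 ℕ.* d) ≈ θ p * θ d
        θ[p*d] = trans (reflexive (≡.cong (λ q → θ (q ℕ.* d)) (ℕ.*-identityʳ p))) (proj₂ θ-mult p d)
      β-step {p} {d} (suc k) pr p∤d = begin
        β n          ≈⟨ β≈μθ n ⟩
        μ n * θ n    ≡⟨ ≡.cong (_* θ n) (μ-square∣ pr p²∣n) ⟩
        0# * θ n     ≈⟨ zeroˡ _ ⟩
        0#           ≈⟨ zeroˡ _ ⟨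
        0# * β d     ∎
        where
        n = p ℕ.^ suc (suc k) ℕ.* d
        instance _ = p^k*m≢0 {m = d} (suc (suc k)) pr
        p²∣n : p ℕ.^ 2 ∣ n
        p²∣n = ∣m⇒∣m*n d (*-monoʳ-∣ p (*-monoʳ-∣ p (1∣ (p ℕ.^ k))))
      p∣⇒δ≡0 : ∀ {p n} → Prime p → p ∣ n → δ n ≡ 0#
      p∣⇒δ≡0 {n = n} pr p∣n = δ-≢1 n λ { ≡.refl → ¬prime[1] (≡.subst Prime (∣1⇒≡1 p∣n) pr) }
      -- The left side is 0 because `p` divides the argument. On the right the two terms cancel for
      -- `k = 0`, and each is 0 for larger `k`.
      δ-step : ∀ {p m} k → Prime p → p ∤ m → .{{NonZero m}} →
               δ (p ℕ.^ suc k ℕ.* m) ≈ θ p * δ (p ℕ.^ k ℕ.* m) + γ p k * δ m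
      δ-step {p} {m} zero pr p∤m = begin
        δ (p ℕ.^ 1 ℕ.* m)                   ≡⟨ p∣⇒δ≡0 pr (∣m⇒∣m*n m (m∣m*n 1)) ⟩
        0#                                  ≈⟨ zeroˡ _ ⟨
        0# * δ m                            ≈⟨ *-congʳ (-‿inverseʳ (θ p)) ⟨
        (θ p + - θ p) * δ m                 ≈⟨ distribʳ _ _ _ ⟩
        θ p * δ m + - θ p * δ m             ≡⟨ ≡.cong (λ i → θ p * δ i + - θ p * δ m) (ℕ.*-identityˡ m) ⟨
        θ p * δ (1 ℕ.* m) + - θ p * δ m     ∎
      δ-step {p} {m} (suc k) pr p∤m = begin
        δ (p ℕ.^ suc (suc k) ℕ.* m)         ≡⟨ p∣⇒δ≡0 pr (∣m⇒∣m*n m (m∣m*n (p ℕ.^ suc k))) ⟩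
        0#                                  ≈⟨ +-identityˡ 0# ⟨
        0# + 0#                             ≈⟨ +-cong (zeroʳ (θ p)) (zeroˡ (δ m)) ⟨
        θ p * 0# + 0# * δ m                 ≡⟨ ≡.cong (λ y → θ p * y + 0# * δ m) δ[p^[1+k]*m]≡0 ⟨
        θ p * δ (p ℕ.^ suc k ℕ.* m) + 0# * δ m ∎
        where
        δ[p^[1+k]*m]≡0 : δ (p ℕ.^ suc k ℕ.* m) ≡ 0#
        δ[p^[1+k]*m]≡0 = p∣⇒δ≡0 pr (∣m⇒∣m*n m (m∣m*n (p ℕ.^ k)))

  -- The gcd and lcm matrices.

  module _ {n} (x : Vector ℕ (suc n)) (x≢0 : ∀ i → NonZero (x i))
    (x-inj : Injective _≡_ _≡_ x) (closed : FactorClosed x) (x₀≡1 : x zero ≡ 1) where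

    diag-primeProduct : ∀ t → diag (primeProduct t ∘ x) ≈ᴹ diag (1# ∷ λ i → primeProduct t (x (suc i)))
    diag-primeProduct t = diag-cong λ where
      -- `primeDivisors 1` computes to the empty list, so the product at 1 is `1#`.
      zero    → reflexive (≡.cong (primeProduct t) x₀≡1)
      (suc i) → refl

    module _ (f : ℕ → Carrier) (a : ℕ) where

      private
        F : ℕ → Carrier
        F n = f n ^ a

      -- With θ = 1 the recursion telescopes: `t p (1 + k)` is the increment of `F` from `p ^ k` to
      -- `p ^ (1 + k)`. Only coprime arguments are split, so multiplicativity is enough.
      gcd-diagonalisation : Multiplicative f →
        B x ᵀ *ᴹ gcdMatrix f a x *ᴹ B x
          ≈ᴹ diag (1# ∷ λ i → primeProduct (λ p v → f (p ℕ.^ v) ^ a - f (p ℕ.^ (v ℕ.∸ 1)) ^ a) (x (suc i)))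
      gcd-diagonalisation f-mult i j = trans
        (Diagonalisation.BᵀMB≈diag x≢0 x-inj closed 1-completelyMultiplicative
          (möbius-inversion 1-completelyMultiplicative (λ n → sym (*-identityʳ (μ n))))
          (Dirichlet.convolution {g = λ p k → t p (suc k)} refl (primeProduct-p^[1+k]*m t)
            (*-pres-CompletelyMultiplicative 1-completelyMultiplicative 1-completelyMultiplicative)
            (proj₁ F-mult) F-step)
          (λ i j k l _ _ → sym (trans (*-congʳ (*-identityˡ 1#)) (*-identityˡ _))) i j)
        (diag-primeProduct t i j)
        where
        t : ℕ → ℕ → Carrier
        t p v = F (p ℕ.^ v) - F (p ℕ.^ (v ℕ.∸ 1))
        F-mult = ^-pres-Multiplicative a f-mult
        F-step : ∀ {p m} k → Prime p → p ∤ m → .{{NonZero m}} →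
          F (p ℕ.^ suc k ℕ.* m) ≈ 1# * 1# * F (p ℕ.^ k ℕ.* m) + t p (suc k) * F m
        F-step {p} {m} k pr p∤m = begin
          F (p ℕ.^ suc k ℕ.* m)                               ≈⟨ F-p^k*m (suc k) ⟩
          F (p ℕ.^ suc k) * F m                               ≈⟨ *-congʳ (//-rightDividesˡ _ _) ⟨
          (t p (suc k) + F (p ℕ.^ k)) * F m                   ≈⟨ *-congʳ (+-comm _ _) ⟩
          (F (p ℕ.^ k) + t p (suc k)) * F m                   ≈⟨ distribʳ _ _ _ ⟩
          F (p ℕ.^ k) * F m + t p (suc k) * F m               ≈⟨ +-congʳ (F-p^k*m k) ⟨
          F (p ℕ.^ k ℕ.* m) + t p (suc k) * F m               ≈⟨ +-congʳ (trans (*-congʳ (*-identityˡ 1#)) (*-identityˡ _)) ⟨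
          1# * 1# * F (p ℕ.^ k ℕ.* m) + t p (suc k) * F m     ∎
          where
          F-p^k*m : ∀ k → F (p ℕ.^ k ℕ.* m) ≈ F (p ℕ.^ k) * F m
          F-p^k*m k = proj₂ F-mult (p ℕ.^ k) m (prime^∤⇒coprime k pr p∤m)
            where instance
              _ = prime⇒nonZero pr
              _ = ℕ.m^n≢0 p k

      gcd-diagonalisation-completely : CompletelyMultiplicative f →
        B x ᵀ *ᴹ gcdMatrix f a x *ᴹ B x
          ≈ᴹ diag (1# ∷ λ i → primeProduct (λ p v → f p ^ (a ℕ.* v) - f p ^ (a ℕ.* (v ℕ.∸ 1))) (x (suc i)))
      gcd-diagonalisation-completely f-mult i j = trans
        (gcd-diagonalisation (completelyMultiplicative⇒multiplicative f-mult) i j)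
        (diag-1∷-cong (λ i → primeProduct-cong t≈u (x (suc i))) i j)
        where
        f[p^v]^a : ∀ {p} → Prime p → ∀ v → f (p ℕ.^ v) ^ a ≈ f p ^ (a ℕ.* v)
        f[p^v]^a {p} pr v = begin
          f (p ℕ.^ v) ^ a    ≈⟨ ^-congˡ a (completelyMultiplicative-^ f-mult p v {{prime⇒nonZero pr}}) ⟩
          (f p ^ v) ^ a      ≈⟨ ^-assocʳ (f p) v a ⟩
          f p ^ (v ℕ.* a)    ≡⟨ ≡.cong (f p ^_) (ℕ.*-comm v a) ⟩
          f p ^ (a ℕ.* v)    ∎
        t≈u : ∀ {p} v → Prime p → f (p ℕ.^ v) ^ a - f (p ℕ.^ (v ℕ.∸ 1)) ^ a
                                ≈ f p ^ (a ℕ.* v) - f p ^ (a ℕ.* (v ℕ.∸ 1))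
        t≈u v pr = +-cong (f[p^v]^a pr v) (-‿cong (f[p^v]^a pr (v ℕ.∸ 1)))

      -- With `u = F p`, the recursion requires `u ^ (1 + k) = u * u * u ^ k + t p (1 +
      -- k)`. This dictates the difference of `u ^ v` and `u ^ (v + 1)` as the factor at `p ^ v`.
      lcm-diagonalisation : CompletelyMultiplicative f →
        Bᶠ f a x ᵀ *ᴹ lcmMatrix f a x *ᴹ Bᶠ f a x
          ≈ᴹ diag (1# ∷ λ i → primeProduct (λ p v → f p ^ (a ℕ.* v) - f p ^ (a ℕ.* (v ℕ.+ 1))) (x (suc i)))
      lcm-diagonalisation f-mult i j = trans
        (Diagonalisation.BᵀMB≈diag x≢0 x-inj closed F-mult
          (möbius-inversion F-mult (λ n → refl))
          (Dirichlet.convolution {g = λ p k → t p (suc k)} refl (primeProduct-p^[1+k]*m t)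
            (*-pres-CompletelyMultiplicative F-mult F-mult) (proj₁ F-mult) F-step)
          F-lcm i j)
        (diag-primeProduct t i j)
        where
        t : ℕ → ℕ → Carrier
        t p v = f p ^ (a ℕ.* v) - f p ^ (a ℕ.* (v ℕ.+ 1))
        F-mult = ^-pres-CompletelyMultiplicative a f-mult
        F-lcm : ∀ i j k l → k ℕ.* gcd (x i) (x j) ≡ x i → l ℕ.* gcd (x i) (x j) ≡ x j →
                F (lcm (x i) (x j)) ≈ F k * F l * F (gcd (x i) (x j))
        F-lcm i j k l k*g≡xi l*g≡xj = begin
          F (lcm (x i) (x j))   ≡⟨ ≡.cong F lcm≡ ⟩
          F (k ℕ.* l ℕ.* g)     ≈⟨ proj₂ F-mult (k ℕ.* l) g ⟩
          F (k ℕ.* l) * F g     ≈⟨ *-congʳ (proj₂ F-mult k l) ⟩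
          F k * F l * F g       ∎
          where
          g = gcd (x i) (x j)
          instance
            xi≢0 = x≢0 i
            xj≢0 = x≢0 j
            g≢0 = m*n≡o⇒n≢0 k g k*g≡xi
            k≢0 = m*n≡o⇒m≢0 k g k*g≡xi
            l≢0 = m*n≡o⇒m≢0 l g l*g≡xj
            kl≢0 = ℕ.m*n≢0 k l
          lcm≡ : lcm (x i) (x j) ≡ k ℕ.* l ℕ.* g
          -- The gcd times the lcm is `x i * x j = (k * g) * (l * g)`; one `g` cancels.
          lcm≡ = ℕ.*-cancelˡ-≡ _ _ g (≡.trans (gcd*lcm (x i) (x j)) (≡.trans
            (≡.cong₂ ℕ._*_ (≡.sym k*g≡xi) (≡.sym l*g≡xj))
            (ℕ-solve 3 (λ k l g → k :*ℕ g :*ℕ (l :*ℕ g) :=ℕ g :*ℕ (k :*ℕ l :*ℕ g)) ≡.refl k l g)))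
        F-step : ∀ {p m} k → Prime p → p ∤ m → .{{NonZero m}} →
          F (p ℕ.^ suc k ℕ.* m) ≈ F p * F p * F (p ℕ.^ k ℕ.* m) + t p (suc k) * F m
        F-step {p} {m} k pr p∤m = begin
          F (p ℕ.^ suc k ℕ.* m)                                         ≈⟨ F-p^k*m (suc k) ⟩
          u ^ suc k * F m                                               ≈⟨ *-congʳ (//-rightDividesˡ _ _) ⟨
          (u ^ suc k - u ^ suc (suc k) + u ^ suc (suc k)) * F m         ≈⟨ *-congʳ (+-comm _ _) ⟩
          (u ^ suc (suc k) + (u ^ suc k - u ^ suc (suc k))) * F m       ≈⟨ distribʳ _ _ _ ⟩
          u ^ suc (suc k) * F m + (u ^ suc k - u ^ suc (suc k)) * F m
            ≈⟨ +-cong (solve 3 (λ u v w → u :* (u :* v) :* w := u :* u :* (v :* w)) refl u (u ^ k) (F m))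
                      (*-congʳ (+-cong (u^v (suc k)) (-‿cong u^[2+k]))) ⟩
          u * u * (u ^ k * F m) + t p (suc k) * F m                     ≈⟨ +-congʳ (*-congˡ (F-p^k*m k)) ⟨
          u * u * F (p ℕ.^ k ℕ.* m) + t p (suc k) * F m                 ∎
          where
          u = F p
          instance _ = prime⇒nonZero pr
          u^v : ∀ v → u ^ v ≈ f p ^ (a ℕ.* v)
          u^v v = ^-assocʳ (f p) a v
          u^[2+k] : u ^ suc (suc k) ≈ f p ^ (a ℕ.* (suc k ℕ.+ 1))
          u^[2+k] = trans (u^v (suc (suc k)))
            (reflexive (≡.cong (λ v → f p ^ (a ℕ.* v)) (ℕ.+-comm 1 (suc k))))
          F-p^k*m : ∀ k → F (p ℕ.^ k ℕ.* m) ≈ u ^ k * F m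
          F-p^k*m k = trans (proj₂ F-mult (p ℕ.^ k) m) (*-congʳ (completelyMultiplicative-^ F-mult p k))
            where instance _ = ℕ.m^n≢0 p k

corollary3p3 : ∀ {c ℓ : Level} (R : CommutativeRing c ℓ) →
    let open Arithmetic R in
    (a : ℕ) .{{_ : NonZero a}} (m : ℕ) (x : Vector ℕ (ℕ.suc m)) →
    (∀ i → NonZero (x i)) →
    Injective _≡_ _≡_ x →
    FactorClosed x →
    x zero ≡ 1 →
    (f : ℕ → Carrier) →
    (Multiplicative f →
    B x ᵀ *ᴹ gcdMatrix f a x *ᴹ B x
    ≈ᴹ diag (1# ∷ λ i → ∏[p∣ x (suc i) ] λ p →
    f (p ℕ.^ ν p (x (suc i))) ^ a - f (p ℕ.^ (ν p (x (suc i)) ℕ.∸ 1)) ^ a))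
    ×
    (CompletelyMultiplicative f →
    (B x ᵀ *ᴹ gcdMatrix f a x *ᴹ B x
    ≈ᴹ diag (1# ∷ λ i → ∏[p∣ x (suc i) ] λ p →
    f p ^ (a ℕ.* ν p (x (suc i))) - f p ^ (a ℕ.* (ν p (x (suc i)) ℕ.∸ 1))))
    ×
    (Bᶠ f a x ᵀ *ᴹ lcmMatrix f a x *ᴹ Bᶠ f a x
    ≈ᴹ diag (1# ∷ λ i → ∏[p∣ x (suc i) ] λ p →
    f p ^ (a ℕ.* ν p (x (suc i))) - f p ^ (a ℕ.* (ν p (x (suc i)) ℕ.+ 1)))))
corollary3p3 R a m x x≢0 x-inj closed x₀≡1 f =
  gcd-diagonalisation R x x≢0 x-inj closed x₀≡1 f a ,
  λ f-mult → gcd-diagonalisation-completely R x x≢0 x-inj closed x₀≡1 f a f-mult ,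
             lcm-diagonalisation R x x≢0 x-inj closed x₀≡1 f a f-mult
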